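{- Let $G$ be any maximal outerplanar graph with $n \geq 4$ vertices. Then there exists a secure total dominating set $S$ of $G$ such that $|S| \leq \lfloor 2n/3 \rfloor$ and $S$ contains no vertex of degree $2$.
   Context: All graphs are finite, simple and undirected. A graph is outerplanar if it has a crossing-free embedding in the plane such that all vertices lie on the boundary of the outer (unbounded) face; it is maximal outerplanar if it is outerplanar and adding any single new edge yields a graph that is not outerplanar. A set $S \subseteq V(G)$ is a total dominating set if every vertex of $G$ (including those in $S$) is adjacent to some vertex of $S$. A total dominating set $S$ is a secure total dominating set if for every $u \in V(G)\setminus S$ there exists $v \in S$ with $uv \in E(G)$ such that $(S\setminus\{v\})\cup\{u\}$ is also a total dominating set. -}

module Defs where

open import Data.Nat using (ℕ; _<_)
open import Data.Fin using (Fin; toℕ; _≟_)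
open import Data.Fin.Subset using (Subset; _∈_; _∉_; ∣_∣; inside; outside)
open import Data.Bool using (Bool; true; false; _∨_; _∧_)
open import Data.Vec using (tabulate; _[_]≔_)
open import Data.Product using (Σ; ∃; _×_)
open import Data.Sum using (_⊎_)
open import Relation.Nullary using (¬_)
open import Relation.Nullary.Decidable using (⌊_⌋)
open import Relation.Binary.PropositionalEquality using (_≡_; _≢_)
open import Function.Definitions using (Injective)

Adj : ℕ → Set
Adj n = Fin n → Fin n → Bool

IsSimple : {n : ℕ} → Adj n → Set
IsSimple {n} E = (∀ (u v : Fin n) → E u v ≡ E v u) × (∀ (u : Fin n) → E u u ≡ false)

Cr : ℕ → ℕ → ℕ → ℕ → Set
Cr a b c d = a < c × c < b × b < d

-- The chords {a,b} and {c,d} of a convex polygon cross (interleave).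
Crosses : ℕ → ℕ → ℕ → ℕ → Set
Crosses a b c d =
  Cr a b c d ⊎ Cr b a c d ⊎ Cr a b d c ⊎ Cr b a d c ⊎
  Cr c d a b ⊎ Cr d c a b ⊎ Cr c d b a ⊎ Cr d c b a

-- Outerplanar: the vertices can be placed on a circle (in the cyclic
-- order given by an injective position map) such that no two edges,
-- drawn as chords, cross.  (Standard combinatorial form of an
-- outerplanar embedding.)
Outerplanar : {n : ℕ} → Adj n → Set
Outerplanar {n} E =
  Σ (Fin n → Fin n) λ pos → Injective _≡_ _≡_ pos ×
    (∀ (a b c d : Fin n) → E a b ≡ true → E c d ≡ true →
       ¬ Crosses (toℕ (pos a)) (toℕ (pos b)) (toℕ (pos c)) (toℕ (pos d)))

addEdge : {n : ℕ} → Adj n → Fin n → Fin n → Adj n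
addEdge E u v x y =
  E x y ∨ ((⌊ x ≟ u ⌋ ∧ ⌊ y ≟ v ⌋) ∨ (⌊ x ≟ v ⌋ ∧ ⌊ y ≟ u ⌋))

MaximalOuterplanar : {n : ℕ} → Adj n → Set
MaximalOuterplanar {n} E =
  Outerplanar E ×
  (∀ (u v : Fin n) → u ≢ v → E u v ≡ false → ¬ Outerplanar (addEdge E u v))

degree : {n : ℕ} → Adj n → Fin n → ℕ
degree E v = ∣ tabulate (E v) ∣

TotalDominating : {n : ℕ} → Adj n → Subset n → Set
TotalDominating {n} E S = ∀ (x : Fin n) → ∃ λ (y : Fin n) → y ∈ S × E x y ≡ true

swap : {n : ℕ} → Subset n → Fin n → Fin n → Subset n
swap S v u = (S [ v ]≔ outside) [ u ]≔ inside

SecureTotalDominating : {n : ℕ} → Adj n → Subset n → Set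
SecureTotalDominating {n} E S =
  TotalDominating E S ×
  (∀ (u : Fin n) → u ∉ S →
     ∃ λ (v : Fin n) → v ∈ S × E u v ≡ true × TotalDominating E (swap S v u))

{-# OPTIONS --safe #-}
-- Place G on a circle, so that it becomes a triangulated polygon, and label the vertices outside S
-- "out" and those in S "clean" or "dirty".  Demand that every vertex has, among its neighbours, a dirty
-- one or two clean ones, that every "out" vertex has a clean neighbour, and that every vertex of S has
-- degree at least 3.  Then S minus any one clean vertex is still totally dominating, so an "out" vertex
-- can be exchanged with any of its clean neighbours.
--
-- Labellings with |S| ≤ 2 |V ∖ S| exist for n ≥ 5 by induction over the polygon cut off by an edge ij:
-- what matters about a partial labelling are the labels of i and j, how far their demands are met, and
-- a lower bound for 2 |V ∖ S| − |S|.  Finitely many sets of such data ("profiles") suffice: the profile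
-- of a side is among them, and gluing two polygons along the apex of the triangle at ij stays within
-- them, which is verified by evaluation.

module Submission where

open import Defs
open import Data.Bool using (Bool; true; false; if_then_else_; _∨_) renaming (_≟_ to _≟ᵇ_)
open import Data.Bool.Properties using (∨-zeroʳ)
open import Data.Empty using (⊥; ⊥-elim)
open import Data.Fin using (Fin; zero; suc; toℕ; _≟_)
open import Data.Fin.Patterns using (0F; 1F; 2F; 3F)
open import Data.Fin.Properties using (toℕ-injective; any?; suc-injective; injective⇒≤)
open import Data.Fin.Subset using (Subset; _∈_; _∉_; ∣_∣)
open import Data.List using (List; []; _∷_; _++_; length; filter; allFin) renaming (lookup to lookupˡ)
open import Data.List.Extrema.Nat using (argmax; argmax-all; f[xs]≤f[argmax]; argmin; argmin-all; f[argmin]≤f[xs])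
open import Data.List.Membership.Propositional using (find) renaming (_∈_ to _∈ˡ_)
open import Data.List.Membership.Propositional.Properties using (∈-filter⁺; ∈-allFin; ∈-++⁺ˡ; ∈-++⁺ʳ)
open import Data.List.Properties using (length-++)
open import Data.List.Relation.Unary.All as All using (All; []; _∷_)
open import Data.List.Relation.Unary.All.Properties using (all-filter)
open import Data.List.Relation.Unary.Any as Any using (Any; here; there)
open import Data.List.Relation.Unary.Any.Properties using (lookup-index)
open import Data.Nat using (ℕ; zero; suc; _+_; _*_; _≤_; _<_; z≤n; s≤s; _⊓_; _≤?_; _<?_)
open import Data.Nat.DivMod using (_/_; /-monoˡ-≤; m*n/n≡m)
open import Data.Nat.Properties hiding (_≟_; _≤?_; _<?_; suc-injective)
open import Data.Nat.Solver using (module +-*-Solver)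
open import Data.Product using (∃; ∃₂; _×_; _,_; proj₁; proj₂)
open import Data.Sum using (_⊎_; inj₁; inj₂)
open import Data.Unit using (tt)
open import Data.Vec using (tabulate; _[_]≔_)
open import Data.Vec.Properties using ([]=⇒lookup; lookup⇒[]=; lookup∘tabulate; []≔-updates; []≔-minimal)
open import Function using (_∘_; case_of_)
open import Function.Definitions using (Injective)
open import Relation.Binary.Definitions using (tri<; tri≈; tri>)
open import Relation.Binary.PropositionalEquality
open import Relation.Nullary using (¬_; Dec; yes; no; contradiction)
open import Relation.Nullary.Decidable using (toWitness; _×-dec_; _→-dec_; ¬?; does; dec-true; dec-false)

open import Algebra.Properties.CommutativeMonoid.Sum +-0-commutativeMonoid
  using (∑-distrib-+; sum-cong-≗; sum-replicate-zero) renaming (sum to ∑)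
open +-*-Solver using (solve; _:=_; _:+_; _:*_; con)

-- Sums over Fin n

∑-mono : ∀ {n} {f g : Fin n → ℕ} → (∀ y → f y ≤ g y) → ∑ f ≤ ∑ g
∑-mono {zero}  f≤g = z≤n
∑-mono {suc n} f≤g = +-mono-≤ (f≤g zero) (∑-mono (f≤g ∘ suc))

∑-const-1 : ∀ n → ∑ {n} (λ _ → 1) ≡ n
∑-const-1 zero    = refl
∑-const-1 (suc n) = cong suc (∑-const-1 n)

δ : ∀ {n} → Fin n → ℕ → Fin n → ℕ
δ z c y = if does (y ≟ z) then c else 0

∑-δ : ∀ {n} (z : Fin n) c → ∑ (δ z c) ≡ c
∑-δ {suc n} zero    c = trans (cong (c +_) (sum-replicate-zero n)) (+-identityʳ c)
∑-δ {suc n} (suc z) c = ∑-δ z c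

∑-superadditive : ∀ {n} (f g h : Fin n → ℕ) → (∀ y → f y + g y ≤ h y) → ∑ f + ∑ g ≤ ∑ h
∑-superadditive f g h p = ≤-trans (≤-reflexive (sym (∑-distrib-+ f g))) (∑-mono p)

value≤∑ : ∀ {n} (f : Fin n → ℕ) y → f y ≤ ∑ f
value≤∑ f zero    = m≤m+n (f zero) _
value≤∑ f (suc y) = ≤-trans (value≤∑ (f ∘ suc) y) (m≤n+m _ (f zero))

∑>0 : ∀ {n} (f : Fin n → ℕ) → 0 < ∑ f → ∃ λ y → 0 < f y
∑>0 {suc n} f p with f zero in eq
... | suc m = zero , subst (0 <_) (sym eq) (s≤s z≤n)
... | zero  = let y , q = ∑>0 (f ∘ suc) p in suc y , q

-- Yields a dominator that survives when v leaves the set: what the sum has beyond its value at v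
-- comes from elsewhere.
∑>value : ∀ {n} (f : Fin n → ℕ) v → f v < ∑ f → ∃ λ y → y ≢ v × 0 < f y
∑>value f zero p =
  let y , q = ∑>0 (f ∘ suc) (+-cancelˡ-< (f zero) 0 (∑ (f ∘ suc)) (subst (_< ∑ f) (sym (+-identityʳ (f zero))) p))
  in suc y , (λ ()) , q
∑>value f (suc v) p with f zero in eq
... | suc m = zero , (λ ()) , subst (0 <_) (sym eq) (s≤s z≤n)
... | zero  = let y , y≢v , q = ∑>value (f ∘ suc) v p in suc y , y≢v ∘ suc-injective , q

bit : Bool → ℕ
bit b = if b then 1 else 0

∣tabulate∣ : ∀ {n} (b : Fin n → Bool) → ∣ tabulate b ∣ ≡ ∑ (bit ∘ b)
∣tabulate∣ {zero}  b = refl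
∣tabulate∣ {suc n} b with b zero
... | true  = cong suc (∣tabulate∣ (b ∘ suc))
... | false = ∣tabulate∣ (b ∘ suc)

-- Labellings

-- The label none marks the vertices outside the part of the polygon labelled so far.
Label : Set
Label = Fin 4

pattern none  = 0F
pattern out   = 1F
pattern clean = 2F
pattern dirty = 3F

selected : Label → Bool
selected none  = false
selected out   = false
selected clean = true
selected dirty = true

sel exc : Label → ℕ
sel l   = bit (selected l)
exc out = 1
exc _   = 0

-- cover l m and support l m are what a neighbour labelled m contributes to the two demands of a vertex
-- labelled l.
cover : Label → Label → ℕ
cover _ none  = 0
cover _ out   = 0
cover _ clean = 1
cover _ dirty = 2

support : Label → Label → ℕ
support out clean = 1
support out _     = 0
support _   none  = 0
support _   _     = 1

-- Cover 2 survives the loss of one clean vertex, which gives only 1. An `out` vertex needs one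
-- clean neighbour as exchange partner; three supporters force a selected vertex to have degree at
-- least 3.
coverDemand supportDemand : Label → ℕ
coverDemand _     = 2
supportDemand out = 1
supportDemand _   = 3

Weight : Set
Weight = Label → Label → ℕ

-- Such weights ignore unlabelled vertices, so a partial labelling can be summed over the whole
-- graph. Wrapping the condition in a record lets `w` be inferred from its proof.
record Vanishing (w : Weight) : Set where
  constructor vanishing
  field on-none : ∀ l → w l none ≡ 0
open Vanishing

cover-vanishing : Vanishing cover
cover-vanishing = vanishing λ _ → refl

support-vanishing : Vanishing support
support-vanishing = vanishing λ { none → refl ; out → refl ; clean → refl ; dirty → refl }

cover>0⇒selected : ∀ l m → 0 < cover l m → selected m ≡ true
cover>0⇒selected _ clean _ = refl
cover>0⇒selected _ dirty _ = refl

support-out>0⇒clean : ∀ m → 0 < support out m → m ≡ clean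
support-out>0⇒clean clean _ = refl

supportDemand-selected : ∀ l → selected l ≡ true → supportDemand l ≡ 3
supportDemand-selected clean _ = refl
supportDemand-selected dirty _ = refl

support≤1 : ∀ l m → support l m ≤ 1
support≤1 none  none  = z≤n
support≤1 none  out   = ≤-refl
support≤1 none  clean = ≤-refl
support≤1 none  dirty = ≤-refl
support≤1 out   none  = z≤n
support≤1 out   out   = z≤n
support≤1 out   clean = ≤-refl
support≤1 out   dirty = z≤n
support≤1 clean none  = z≤n
support≤1 clean out   = ≤-refl
support≤1 clean clean = ≤-refl
support≤1 clean dirty = ≤-refl
support≤1 dirty none  = z≤n
support≤1 dirty out   = ≤-refl
support≤1 dirty clean = ≤-refl
support≤1 dirty dirty = ≤-refl

sel+exc : ∀ l → l ≢ none → sel l + exc l ≡ 1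
sel+exc none  l≢none = contradiction refl l≢none
sel+exc out   _ = refl
sel+exc clean _ = refl
sel+exc dirty _ = refl

-- What is known about an end of the edge: its label and lower bounds for the contributions received.
record End : Set where
  constructor _⟨_,_⟩
  field
    label      : Label
    coverage   : ℕ
    supporters : ℕ
open End

-- Bounds may be understated, so they can be capped at the demands and finitely many ends suffice.
_⊑_ : End → End → Set
d ⊑ e = label d ≡ label e × coverage d ≤ coverage e × supporters d ≤ supporters e

_⊑?_ : ∀ d e → Dec (d ⊑ e)
d ⊑? e = label d ≟ label e ×-dec coverage d ≤? coverage e ×-dec supporters d ≤? supporters e

demand : Label → End
demand l = l ⟨ coverDemand l , supportDemand l ⟩

extend : End → Label → End
extend (l ⟨ c , s ⟩) m = l ⟨ c + cover l m , s + support l m ⟩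

fuse : End → End → End
fuse (l ⟨ c , s ⟩) (_ ⟨ c′ , s′ ⟩) = l ⟨ c + c′ , s + s′ ⟩

-- The labelling of a polygon at the edge ij, counting i and j, satisfies |S| + slack ≤ 2 |V ∖ S| + 6; the
-- shift by 6 makes every slack needed a natural number.
record Option : Set where
  constructor option
  field
    left right : End
    slack      : ℕ
open Option

sideEnd : Label → Label → End
sideEnd l m = l ⟨ cover l m , support l m ⟩

-- Soundness of `o` for the polygon that is just the edge ij, phrased without a graph so that it can
-- be decided by evaluation.
Side : Option → Set
Side o =
  l ≢ none × m ≢ none × left o ⊑ sideEnd l m × right o ⊑ sideEnd m l ×
  sel l + sel m + slack o ≤ 2 * (exc l + exc m) + 6
  where
  l = label (left o)
  m = label (right o)

-- o is obtained from o₁ at ik and o₂ at kj by adding the edge ij, which makes k an inner vertex.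
Step : Option → Option → Option → Set
Step o₁ o₂ o =
  label k ≡ label (left o₂) × label k ≢ none ×
  demand (label k) ⊑ fuse k (left o₂) ×
  left o ⊑ extend (left o₁) (label (right o₂)) ×
  right o ⊑ extend (right o₂) (label (left o₁)) ×
  -- Adding the balances of the two halves counts k twice and the shift by 6 twice; one copy of each
  -- is taken off.
  slack o + 6 + 2 * exc (label k) ≤ slack o₁ + slack o₂ + sel (label k)
  where k = right o₁

-- Settled labellings yield secure total dominating sets

module _ {n : ℕ} (E : Adj n) where

  term : Weight → (Fin n → Label) → Fin n → Fin n → ℕ
  term w ℓ x y = if E x y then w (ℓ x) (ℓ y) else 0

  reach : Weight → (Fin n → Label) → Fin n → ℕ
  reach w ℓ x = ∑ (term w ℓ x)

  record Settled (ℓ : Fin n → Label) (x : Fin n) : Set where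
    constructor mkSettled
    field
      labelled  : ℓ x ≢ none
      covered   : coverDemand   (ℓ x) ≤ reach cover   ℓ x
      supported : supportDemand (ℓ x) ≤ reach support ℓ x

  chosen : (Fin n → Label) → Subset n
  chosen ℓ = tabulate (selected ∘ ℓ)

  ∈-chosen : ∀ ℓ {x} → selected (ℓ x) ≡ true → x ∈ chosen ℓ
  ∈-chosen ℓ {x} p = lookup⇒[]= x _ (trans (lookup∘tabulate _ x) p)

  chosen-∈ : ∀ ℓ {x} → x ∈ chosen ℓ → selected (ℓ x) ≡ true
  chosen-∈ ℓ {x} p = trans (sym (lookup∘tabulate _ x)) ([]=⇒lookup p)

  ∈-swap : ∀ {S : Subset n} {v u y} → y ∈ S → y ≢ v → y ∈ swap S v u
  ∈-swap {S} {v} {u} {y} y∈S y≢v with y ≟ u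
  ... | yes refl = []≔-updates (S [ v ]≔ _) y
  ... | no y≢u   = []≔-minimal _ y u y≢u ([]≔-minimal S y v y≢v y∈S)

  term>0 : ∀ w ℓ x y → 0 < term w ℓ x y → E x y ≡ true × 0 < w (ℓ x) (ℓ y)
  term>0 w ℓ x y p with E x y
  ... | true = refl , p

  term≤ : ∀ w ℓ x y → term w ℓ x y ≤ w (ℓ x) (ℓ y)
  term≤ w ℓ x y with E x y
  ... | true  = ≤-refl
  ... | false = z≤n

  module Sufficient (ℓ : Fin n → Label) (settled : ∀ x → Settled ℓ x) where
    open module S x = Settled (settled x)

    -- A clean vertex contributes only 1 to the cover of its neighbours, which demand 2.
    otherNeighbour : ∀ v → ℓ v ≡ clean → ∀ x →
      ∃ λ y → y ≢ v × y ∈ chosen ℓ × E x y ≡ true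
    otherNeighbour v ℓv x =
      let y , y≢v , p = ∑>value (term cover ℓ x) v (≤-trans (s≤s v≤1) (covered x))
          e , q       = term>0 cover ℓ x y p
      in y , y≢v , ∈-chosen ℓ (cover>0⇒selected (ℓ x) (ℓ y) q) , e
      where
      v≤1 : term cover ℓ x v ≤ 1
      v≤1 = ≤-trans (term≤ cover ℓ x v) (≤-reflexive (cong (cover (ℓ x)) ℓv))

    total : TotalDominating E (chosen ℓ)
    total x =
      let y , p = ∑>0 (term cover ℓ x) (≤-trans (s≤s z≤n) (covered x))
          e , q = term>0 cover ℓ x y p
      in y , ∈-chosen ℓ (cover>0⇒selected (ℓ x) (ℓ y) q) , e

    ∉-chosen : ∀ {u} → u ∉ chosen ℓ → ℓ u ≡ out
    ∉-chosen {u} u∉ with ℓ u in eq | labelled u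
    ... | none  | l≢none = contradiction refl l≢none
    ... | out   | _      = refl
    ... | clean | _      = contradiction (∈-chosen ℓ (cong selected eq)) u∉
    ... | dirty | _      = contradiction (∈-chosen ℓ (cong selected eq)) u∉

    cleanNeighbour : ∀ u → ℓ u ≡ out → ∃ λ v → ℓ v ≡ clean × E u v ≡ true
    cleanNeighbour u ℓu =
      let v , p = ∑>0 (term support ℓ u) (subst (λ l → supportDemand l ≤ reach support ℓ u) ℓu (supported u))
          e , q = term>0 support ℓ u v p
      in v , support-out>0⇒clean (ℓ v) (subst (λ l → 0 < support l (ℓ v)) ℓu q) , e

    secure : SecureTotalDominating E (chosen ℓ)
    secure = total , λ u u∉ →
      let v , ℓv , e = cleanNeighbour u (∉-chosen u∉)
      in v , ∈-chosen ℓ (cong selected ℓv) , e , λ x →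
         let y , y≢v , y∈ , e′ = otherNeighbour v ℓv x in y , ∈-swap y∈ y≢v , e′

    reach≤degree : ∀ x → reach support ℓ x ≤ degree E x
    reach≤degree x = ≤-trans (∑-mono pointwise) (≤-reflexive (sym (∣tabulate∣ (E x))))
      where
      pointwise : ∀ y → term support ℓ x y ≤ bit (E x y)
      pointwise y with E x y
      ... | true  = support≤1 (ℓ x) (ℓ y)
      ... | false = z≤n

    3≤degree : ∀ x → x ∈ chosen ℓ → 3 ≤ degree E x
    3≤degree x x∈ = ≤-trans (≤-reflexive (sym (supportDemand-selected (ℓ x) (chosen-∈ ℓ x∈))))
                            (≤-trans (supported x) (reach≤degree x))

    degree≢2 : ∀ x → x ∈ chosen ℓ → degree E x ≢ 2
    degree≢2 x x∈ eq = <-irrefl refl (subst (3 ≤_) eq (3≤degree x x∈))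

    -- Every vertex is either selected or `out`, so s + e = n, and s ≤ 2e becomes 3s ≤ 2s + 2e = 2n.
    ∣chosen∣≤2n/3 : ∑ (sel ∘ ℓ) ≤ 2 * ∑ (exc ∘ ℓ) → ∣ chosen ℓ ∣ ≤ (2 * n) / 3
    ∣chosen∣≤2n/3 s≤2e = begin
      ∣ chosen ℓ ∣    ≡⟨ ∣tabulate∣ (selected ∘ ℓ) ⟩
      s               ≡⟨ m*n/n≡m s 3 ⟨
      s * 3 / 3       ≤⟨ /-monoˡ-≤ 3 3s≤2n ⟩
      (2 * n) / 3     ∎
      where
      open ≤-Reasoning
      s = ∑ (sel ∘ ℓ)
      e = ∑ (exc ∘ ℓ)
      s+e≡n : s + e ≡ n
      s+e≡n = begin-equality
        s + e                                                  ≡⟨ ∑-distrib-+ (sel ∘ ℓ) (exc ∘ ℓ) ⟨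
        ∑ (λ x → sel (ℓ x) + exc (ℓ x))                        ≡⟨ sum-cong-≗ (λ x → sel+exc (ℓ x) (labelled x)) ⟩
        ∑ {n} (λ _ → 1)                                        ≡⟨ ∑-const-1 n ⟩
        n                                                      ∎
      3s≤2n : s * 3 ≤ 2 * n
      3s≤2n = begin
        s * 3          ≡⟨ solve 1 (λ s → s :* con 3 := con 2 :* s :+ s) refl s ⟩
        2 * s + s      ≤⟨ +-monoʳ-≤ (2 * s) s≤2e ⟩
        2 * s + 2 * e  ≡⟨ *-distribˡ-+ 2 s e ⟨
        2 * (s + e)    ≡⟨ cong (2 *_) s+e≡n ⟩
        2 * n          ∎

  -- Restricting and gluing partial labellings

  Extends : (ℓ′ ℓ : Fin n → Label) → Set
  Extends ℓ′ ℓ = ∀ y → ℓ′ y ≡ ℓ y ⊎ ℓ′ y ≡ none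

  term-none : ∀ {w} → Vanishing w → ∀ ℓ x y → ℓ y ≡ none → term w ℓ x y ≡ 0
  term-none {w} van ℓ x y eq with E x y
  ... | true  = trans (cong (w (ℓ x)) eq) (on-none van (ℓ x))
  ... | false = refl

  module _ {w : Weight} (van : Vanishing w) {ℓ′ ℓ : Fin n → Label} (ext : Extends ℓ′ ℓ) where

    term-mono : ∀ {x} → ℓ′ x ≡ ℓ x → ∀ y → term w ℓ′ x y ≤ term w ℓ x y
    term-mono {x} eqx y with ext y
    ... | inj₁ eqy = ≤-reflexive (cong₂ (λ l m → if E x y then w l m else 0) eqx eqy)
    ... | inj₂ eqy = subst (_≤ term w ℓ x y) (sym (term-none van ℓ′ x y eqy)) z≤n

    reach-mono : ∀ {x} → ℓ′ x ≡ ℓ x → reach w ℓ′ x ≤ reach w ℓ x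
    reach-mono eqx = ∑-mono (term-mono eqx)

    -- Under `ℓ′` the term of z is zero, so its contribution comes on top of all that was counted
    -- before.
    reach-neighbour : ∀ {x z} → ℓ′ x ≡ ℓ x → E x z ≡ true → ℓ′ z ≡ none →
      reach w ℓ′ x + w (ℓ x) (ℓ z) ≤ reach w ℓ x
    reach-neighbour {x} {z} eqx e ℓ′z = subst (λ c → reach w ℓ′ x + c ≤ reach w ℓ x) (∑-δ z c)
      (∑-superadditive (term w ℓ′ x) (δ z c) (term w ℓ x) pointwise)
      where
      c = w (ℓ x) (ℓ z)
      pointwise : ∀ y → term w ℓ′ x y + δ z c y ≤ term w ℓ x y
      pointwise y with y ≟ z
      ... | no _     = subst (_≤ term w ℓ x y) (sym (+-identityʳ _)) (term-mono eqx y)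
      ... | yes refl = ≤-reflexive (trans (cong (_+ c) (term-none van ℓ′ x y ℓ′z))
                         (cong (λ b → if b then c else 0) (sym e)))

  record Meets (ℓ : Fin n → Label) (x : Fin n) (e : End) : Set where
    constructor mkMeets
    field
      hasLabel   : ℓ x ≡ label e
      hasCover   : coverage e ≤ reach cover ℓ x
      hasSupport : supporters e ≤ reach support ℓ x

  weaken : ∀ {ℓ x d e} → d ⊑ e → Meets ℓ x e → Meets ℓ x d
  weaken (p , q , r) (mkMeets a b c) = mkMeets (trans a (sym p)) (≤-trans q b) (≤-trans r c)

  settle : ∀ {ℓ x e} → label e ≢ none → demand (label e) ⊑ e → Meets ℓ x e → Settled ℓ x
  settle {ℓ} {x} {e} l≢none d⊑e m = mkSettled (λ eq → l≢none (trans (sym hasLabel) eq))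
    (subst (λ l → coverDemand l ≤ reach cover ℓ x) (sym hasLabel) hasCover)
    (subst (λ l → supportDemand l ≤ reach support ℓ x) (sym hasLabel) hasSupport)
    where open Meets (weaken d⊑e m)

  settled-mono : ∀ {ℓ′ ℓ x} → Extends ℓ′ ℓ → ℓ′ x ≡ ℓ x → Settled ℓ′ x → Settled ℓ x
  settled-mono {ℓ′} {ℓ} {x} ext eq (mkSettled a b c) = mkSettled
    (subst (_≢ none) eq a)
    (≤-trans (subst (λ l → coverDemand l ≤ reach cover ℓ′ x) eq b) (reach-mono cover-vanishing ext eq))
    (≤-trans (subst (λ l → supportDemand l ≤ reach support ℓ′ x) eq c) (reach-mono support-vanishing ext eq))

  meets-neighbour : ∀ {ℓ′ ℓ x z e m} → Extends ℓ′ ℓ → ℓ′ x ≡ ℓ x → E x z ≡ true → ℓ′ z ≡ none → ℓ z ≡ m →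
    Meets ℓ′ x e → Meets ℓ x (extend e m)
  meets-neighbour {ℓ′} {ℓ} {x} {z} {l ⟨ c , s ⟩} ext eq e ℓ′z refl (mkMeets a p q)
    with trans (sym eq) a
  ... | refl = mkMeets refl
    (≤-trans (+-monoˡ-≤ (cover (ℓ x) (ℓ z)) p) (reach-neighbour cover-vanishing ext eq e ℓ′z))
    (≤-trans (+-monoˡ-≤ (support (ℓ x) (ℓ z)) q) (reach-neighbour support-vanishing ext eq e ℓ′z))

  -- Says, vertex by vertex, that `ℓ` is the union of `ℓ₁` and `ℓ₂` and that only k may be labelled
  -- by both. Ranks are left out, since the gluing estimates depend on nothing else.
  data Overlap (k : Fin n) (ℓ₁ ℓ₂ ℓ : Fin n → Label) (y : Fin n) : Set where
    before : y ≢ k → ℓ₁ y ≡ ℓ y → ℓ₂ y ≡ none → Overlap k ℓ₁ ℓ₂ ℓ y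
    at     : y ≡ k → ℓ₁ y ≡ ℓ y → ℓ₂ y ≡ ℓ y → Overlap k ℓ₁ ℓ₂ ℓ y
    after  : y ≢ k → ℓ₁ y ≡ none → ℓ₂ y ≡ ℓ y → Overlap k ℓ₁ ℓ₂ ℓ y

  module Gluing (loopless : ∀ u → E u u ≡ false) {k : Fin n} {ℓ₁ ℓ₂ ℓ : Fin n → Label}
                (seam : ∀ y → Overlap k ℓ₁ ℓ₂ ℓ y) where

    extends₁ : Extends ℓ₁ ℓ
    extends₁ y with seam y
    ... | before _ p _ = inj₁ p
    ... | at _ p _     = inj₁ p
    ... | after _ p _  = inj₂ p

    extends₂ : Extends ℓ₂ ℓ
    extends₂ y with seam y
    ... | before _ _ p = inj₂ p
    ... | at _ _ p     = inj₁ p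
    ... | after _ _ p  = inj₁ p

    agree-at : ℓ₁ k ≡ ℓ k × ℓ₂ k ≡ ℓ k
    agree-at with seam k
    ... | before k≢k _ _ = contradiction refl k≢k
    ... | at _ p q       = p , q
    ... | after k≢k _ _  = contradiction refl k≢k

    -- A vertex other than k is counted by at most one half, and k itself adds nothing to its own
    -- reach because there are no loops.
    reach-fuse : ∀ {w} → Vanishing w → reach w ℓ₁ k + reach w ℓ₂ k ≤ reach w ℓ k
    reach-fuse {w} van = ∑-superadditive (term w ℓ₁ k) (term w ℓ₂ k) (term w ℓ k) pointwise
      where
      pointwise : ∀ y → term w ℓ₁ k y + term w ℓ₂ k y ≤ term w ℓ k y
      pointwise y with seam y
      ... | before _ _ p = subst (_≤ term w ℓ k y)
        (sym (trans (cong (term w ℓ₁ k y +_) (term-none van ℓ₂ k y p)) (+-identityʳ _)))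
        (term-mono van extends₁ (proj₁ agree-at) y)
      ... | after _ p _  = subst (_≤ term w ℓ k y)
        (sym (cong (_+ term w ℓ₂ k y) (term-none van ℓ₁ k y p)))
        (term-mono van extends₂ (proj₂ agree-at) y)
      ... | at refl _ _ rewrite loopless y = z≤n

    meets-fuse : ∀ {d e} → Meets ℓ₁ k d → Meets ℓ₂ k e → Meets ℓ k (fuse d e)
    meets-fuse {l ⟨ c , s ⟩} {l′ ⟨ c′ , s′ ⟩} (mkMeets a p q) (mkMeets a′ p′ q′) = mkMeets
      (trans (sym (proj₁ agree-at)) a)
      (≤-trans (+-mono-≤ p p′) (reach-fuse cover-vanishing))
      (≤-trans (+-mono-≤ q q′) (reach-fuse support-vanishing))

    -- The surplus `f (ℓ k)` arises because both halves count k; the function `δ` turns it into a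
    -- pointwise identity.
    ∑-fuse : (f : Label → ℕ) → f none ≡ 0 → ∑ (f ∘ ℓ₁) + ∑ (f ∘ ℓ₂) ≡ ∑ (f ∘ ℓ) + f (ℓ k)
    ∑-fuse f f-none = begin
      ∑ (f ∘ ℓ₁) + ∑ (f ∘ ℓ₂)                ≡⟨ ∑-distrib-+ (f ∘ ℓ₁) (f ∘ ℓ₂) ⟨
      ∑ (λ y → f (ℓ₁ y) + f (ℓ₂ y))          ≡⟨ sum-cong-≗ pointwise ⟩
      ∑ (λ y → f (ℓ y) + δ k (f (ℓ k)) y)    ≡⟨ ∑-distrib-+ (f ∘ ℓ) (δ k (f (ℓ k))) ⟩
      ∑ (f ∘ ℓ) + ∑ (δ k (f (ℓ k)))          ≡⟨ cong (∑ (f ∘ ℓ) +_) (∑-δ k (f (ℓ k))) ⟩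
      ∑ (f ∘ ℓ) + f (ℓ k)                    ∎
      where
      open ≡-Reasoning
      pointwise : ∀ y → f (ℓ₁ y) + f (ℓ₂ y) ≡ f (ℓ y) + δ k (f (ℓ k)) y
      pointwise y with seam y | y ≟ k
      ... | before y≢k _ _ | yes y≡k  = contradiction y≡k y≢k
      ... | before _ p q   | no _     = cong₂ _+_ (cong f p) (trans (cong f q) f-none)
      ... | at _ p q       | yes refl = cong₂ _+_ (cong f p) (cong f q)
      ... | at y≡k _ _     | no y≢k   = contradiction y≡k y≢k
      ... | after y≢k _ _  | yes y≡k  = contradiction y≡k y≢k
      ... | after _ p q    | no _     =
        trans (cong₂ _+_ (trans (cong f p) f-none) (cong f q)) (+-comm 0 (f (ℓ y)))

    balance-fuse : ∀ {a₁ a₂ a} →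
      ∑ (sel ∘ ℓ₁) + a₁ ≤ 2 * ∑ (exc ∘ ℓ₁) + 6 → ∑ (sel ∘ ℓ₂) + a₂ ≤ 2 * ∑ (exc ∘ ℓ₂) + 6 →
      a + 6 + 2 * exc (ℓ k) ≤ a₁ + a₂ + sel (ℓ k) → ∑ (sel ∘ ℓ) + a ≤ 2 * ∑ (exc ∘ ℓ) + 6
    balance-fuse {a₁} {a₂} {a} b₁ b₂ b = +-cancelʳ-≤ (6 + 2 * exc (ℓ k)) _ _ (begin
      s + a + (6 + 2 * e)             ≡⟨ solve 3 (λ s a e → s :+ a :+ (con 6 :+ con 2 :* e) := s :+ (a :+ con 6 :+ con 2 :* e)) refl s a e ⟩
      s + (a + 6 + 2 * e)             ≤⟨ +-monoʳ-≤ s b ⟩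
      s + (a₁ + a₂ + sel (ℓ k))       ≡⟨ solve 4 (λ s a₁ a₂ m → s :+ (a₁ :+ a₂ :+ m) := (s :+ m) :+ (a₁ :+ a₂)) refl s a₁ a₂ (sel (ℓ k)) ⟩
      (s + sel (ℓ k)) + (a₁ + a₂)     ≡⟨ cong (_+ (a₁ + a₂)) (∑-fuse sel refl) ⟨
      (s₁ + s₂) + (a₁ + a₂)           ≡⟨ solve 4 (λ s₁ s₂ a₁ a₂ → (s₁ :+ s₂) :+ (a₁ :+ a₂) := (s₁ :+ a₁) :+ (s₂ :+ a₂)) refl s₁ s₂ a₁ a₂ ⟩
      (s₁ + a₁) + (s₂ + a₂)           ≤⟨ +-mono-≤ b₁ b₂ ⟩
      (2 * e₁ + 6) + (2 * e₂ + 6)     ≡⟨ solve 2 (λ e₁ e₂ → (con 2 :* e₁ :+ con 6) :+ (con 2 :* e₂ :+ con 6) := con 2 :* (e₁ :+ e₂) :+ con 12) refl e₁ e₂ ⟩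
      2 * (e₁ + e₂) + 12              ≡⟨ cong (λ z → 2 * z + 12) (∑-fuse exc refl) ⟩
      2 * (∑ (exc ∘ ℓ) + e) + 12      ≡⟨ solve 2 (λ t e → con 2 :* (t :+ e) :+ con 12 := con 2 :* t :+ con 6 :+ (con 6 :+ con 2 :* e)) refl (∑ (exc ∘ ℓ)) e ⟩
      2 * ∑ (exc ∘ ℓ) + 6 + (6 + 2 * e) ∎)
      where
      open ≤-Reasoning
      s = ∑ (sel ∘ ℓ)
      s₁ = ∑ (sel ∘ ℓ₁)
      s₂ = ∑ (sel ∘ ℓ₂)
      e = exc (ℓ k)
      e₁ = ∑ (exc ∘ ℓ₁)
      e₂ = ∑ (exc ∘ ℓ₂)

-- Triangulations

module _ {n : ℕ} (E : Adj n) (rank : Fin n → ℕ) where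

  -- A triangulated polygon on the vertices ranked from i to j, seen from its edge ij as a binary
  -- tree: the branch nodes are the triangles, the leaves are the boundary edges other than ij.
  data Triangulated (i j : Fin n) : Set where
    side     : rank i < rank j → (∀ x → rank i < rank x → rank x < rank j → ⊥) →
               E i j ≡ true → Triangulated i j
    triangle : ∀ k → rank i < rank k → rank k < rank j → E i j ≡ true →
               Triangulated i k → Triangulated k j → Triangulated i j

  sides : ∀ {i j} → Triangulated i j → ℕ
  sides (side _ _ _)           = 1
  sides (triangle _ _ _ _ s t) = sides s + sides t

  -- The vertices strictly between i and j are finished; later gluings bring new contributions only
  -- at i and j, and the option records the state of exactly these two.
  record Realised (i j : Fin n) (o : Option) : Set where
    constructor mkRealised
    field
      labelling : Fin n → Label
      none-left  : ∀ y → rank y < rank i → labelling y ≡ none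
      none-right : ∀ y → rank j < rank y → labelling y ≡ none
      meets-left  : Meets E labelling i (left o)
      meets-right : Meets E labelling j (right o)
      settled : ∀ x → rank i < rank x → rank x < rank j → Settled E labelling x
      balance : ∑ (sel ∘ labelling) + slack o ≤ 2 * ∑ (exc ∘ labelling) + 6

  module _ (symmetric : ∀ u v → E u v ≡ E v u) (loopless : ∀ u → E u u ≡ false)
           (rank-injective : ∀ {x y} → rank x ≡ rank y → x ≡ y) where

    -- Soundness of `Step`: the two labellings agree at k, so they glue; k is settled by what it
    -- receives from both sides, and i and j each gain the other as a neighbour.
    realise-triangle : ∀ {i k j o₁ o₂ o} → rank i < rank k → rank k < rank j → E i j ≡ true →
      Step o₁ o₂ o → Realised i k o₁ → Realised k j o₂ → Realised i j o
    realise-triangle {i} {k} {j} {o₁} {o₂} {o} i<k k<j e (l≡ , l≢none , d , dˡ , dʳ , b)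
      (mkRealised ℓ₁ left₁ right₁ meetsˡ₁ meetsʳ₁ settled₁ balance₁)
      (mkRealised ℓ₂ left₂ right₂ meetsˡ₂ meetsʳ₂ settled₂ balance₂) =
      mkRealised ℓ
        (λ y y<i → trans (sym (agree₁ y (<-asym (<-trans y<i i<k)))) (left₁ y y<i))
        (λ y j<y → trans (sym (agree₂ y (<-trans k<j j<y))) (right₂ y j<y))
        -- The vertex j lies beyond k and is unlabelled in `ℓ₁`, so the edge ij adds a contribution
        -- at i that has not been counted yet.
        (weaken E dˡ (meets-neighbour E extends₁ (agree₁ i (<-asym i<k)) e (right₁ j k<j)
          (trans (sym (agree₂ j k<j)) (hasLabel meetsʳ₂)) meetsˡ₁))
        (weaken E dʳ (meets-neighbour E extends₂ (agree₂ j k<j) (trans (symmetric j i) e) (left₂ i i<k)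
          (trans (sym (agree₁ i (<-asym i<k))) (hasLabel meetsˡ₁)) meetsʳ₂))
        inner
        (balance-fuse {slack o₁} {slack o₂} {slack o} balance₁ balance₂
          (subst (λ l → slack o + 6 + 2 * exc l ≤ slack o₁ + slack o₂ + sel l) (sym ℓk) b))
      where
      open Meets
      -- The vertex k falls to `ℓ₁`; by `ℓ₁k≡ℓ₂k` the choice is immaterial.
      ℓ : Fin n → Label
      ℓ y = if does (rank k <? rank y) then ℓ₂ y else ℓ₁ y
      agree₁ : ∀ y → ¬ rank k < rank y → ℓ₁ y ≡ ℓ y
      agree₁ y k≮y = cong (if_then ℓ₂ y else ℓ₁ y) (sym (dec-false (rank k <? rank y) k≮y))
      agree₂ : ∀ y → rank k < rank y → ℓ₂ y ≡ ℓ y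
      agree₂ y k<y = cong (if_then ℓ₂ y else ℓ₁ y) (sym (dec-true (rank k <? rank y) k<y))
      ℓ₁k≡ℓ₂k : ℓ₁ k ≡ ℓ₂ k
      ℓ₁k≡ℓ₂k = trans (hasLabel meetsʳ₁) (trans l≡ (sym (hasLabel meetsˡ₂)))
      seam : ∀ y → Overlap E k ℓ₁ ℓ₂ ℓ y
      seam y with <-cmp (rank y) (rank k)
      ... | tri< y<k y≢k _ = before (y≢k ∘ cong rank) (agree₁ y (<-asym y<k)) (left₂ y y<k)
      ... | tri> _ y≢k k<y = after (y≢k ∘ cong rank) (right₁ y k<y) (agree₂ y k<y)
      ... | tri≈ _ y≡k _ with rank-injective y≡k
      ...   | refl = at refl (agree₁ k (<-irrefl refl)) (trans (sym ℓ₁k≡ℓ₂k) (agree₁ k (<-irrefl refl)))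
      open Gluing E loopless seam
      ℓk : ℓ k ≡ label (right o₁)
      ℓk = trans (sym (proj₁ agree-at)) (hasLabel meetsʳ₁)
      inner : ∀ x → rank i < rank x → rank x < rank j → Settled E ℓ x
      inner x i<x x<j with <-cmp (rank x) (rank k)
      ... | tri< x<k _ _ = settled-mono E extends₁ (agree₁ x (<-asym x<k)) (settled₁ x i<x x<k)
      ... | tri> _ _ k<x = settled-mono E extends₂ (agree₂ x k<x) (settled₂ x k<x x<j)
      ... | tri≈ _ x≡k _ with rank-injective x≡k
      ...   | refl = settle E {e = fuse (right o₁) (left o₂)} l≢none d (meets-fuse meetsʳ₁ meetsˡ₂)

    realise-side : ∀ {i j o} → rank i < rank j → (∀ x → rank i < rank x → rank x < rank j → ⊥) →
      E i j ≡ true → Side o → Realised i j o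
    realise-side {i} {j} {o} i<j empty e (_ , _ , dˡ , dʳ , b) = mkRealised ℓ
      (λ y y<i → ℓ-none y (λ { refl → <-irrefl refl y<i }) (λ { refl → <-asym i<j y<i }))
      (λ y j<y → ℓ-none y (λ { refl → <-asym i<j j<y }) (λ { refl → <-irrefl refl j<y }))
      (weaken E dˡ (meets-side ℓi ℓj e))
      (weaken E dʳ (meets-side ℓj ℓi (trans (symmetric j i) e)))
      (λ x i<x x<j → ⊥-elim (empty x i<x x<j))
      (subst₂ (λ s t → s + slack o ≤ 2 * t + 6) (sym (∑-side sel refl)) (sym (∑-side exc refl)) b)
      where
      l = label (left o)
      m = label (right o)
      ℓ : Fin n → Label
      ℓ y = if does (y ≟ i) then l else if does (y ≟ j) then m else none
      j≢i : j ≢ i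
      j≢i refl = <-irrefl refl i<j
      ℓi : ℓ i ≡ l
      ℓi rewrite dec-true (i ≟ i) refl = refl
      ℓj : ℓ j ≡ m
      ℓj rewrite dec-false (j ≟ i) j≢i | dec-true (j ≟ j) refl = refl
      ℓ-none : ∀ y → y ≢ i → y ≢ j → ℓ y ≡ none
      ℓ-none y y≢i y≢j rewrite dec-false (y ≟ i) y≢i | dec-false (y ≟ j) y≢j = refl
      side≤reach : ∀ {x y l m} w → ℓ x ≡ l → ℓ y ≡ m → E x y ≡ true → w l m ≤ reach E w ℓ x
      side≤reach {x} {y} w refl refl e = ≤-trans
        (≤-reflexive (cong (λ b → if b then w (ℓ x) (ℓ y) else 0) (sym e)))
        (value≤∑ (term E w ℓ x) y)
      meets-side : ∀ {x y l m} → ℓ x ≡ l → ℓ y ≡ m → E x y ≡ true → Meets E ℓ x (sideEnd l m)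
      meets-side ℓx ℓy e = mkMeets ℓx (side≤reach cover ℓx ℓy e) (side≤reach support ℓx ℓy e)
      ∑-side : (f : Label → ℕ) → f none ≡ 0 → ∑ (f ∘ ℓ) ≡ f l + f m
      ∑-side f f-none = begin
        ∑ (f ∘ ℓ)                              ≡⟨ sum-cong-≗ pointwise ⟩
        ∑ (λ y → δ i (f l) y + δ j (f m) y)    ≡⟨ ∑-distrib-+ (δ i (f l)) (δ j (f m)) ⟩
        ∑ (δ i (f l)) + ∑ (δ j (f m))          ≡⟨ cong₂ _+_ (∑-δ i (f l)) (∑-δ j (f m)) ⟩
        f l + f m                              ∎
        where
        open ≡-Reasoning
        pointwise : ∀ y → f (ℓ y) ≡ δ i (f l) y + δ j (f m) y
        pointwise y with y ≟ i | y ≟ j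
        ... | yes refl | yes refl = contradiction refl j≢i
        ... | yes _    | no _     = sym (+-identityʳ (f l))
        ... | no _     | yes _    = refl
        ... | no _     | no _     = f-none

-- Profiles

-- A size below 4 bounds the number of sides other than ij from above; polygons that small need not have a
-- complete option.
record Profile : Set where
  constructor profile
  field
    size    : ℕ
    options : List Option
open Profile

-- The condition at the outer edge: both ends must have their demands met as well, and slack 6
-- cancels the shift, leaving at most twice as many selected vertices as `out` ones.
Complete : Option → Set
Complete o = label (left o) ≢ none × label (right o) ≢ none ×
  demand (label (left o)) ⊑ left o × demand (label (right o)) ⊑ right o × 6 ≤ slack o

-- Each option of `r` has to arise from some pair of options; combinations that `r` does not list
-- are forgotten. Sizes are capped at 4, the number of sides other than ij in a pentagon, from which
-- on a complete option is required.
Joins : Profile → Profile → Profile → Set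
Joins p q r = 4 ⊓ (size p + size q) ≤ size r ×
  All (λ o → Any (λ o₁ → Any (λ o₂ → Step o₁ o₂ o) (options q)) (options p)) (options r)

step? : ∀ o₁ o₂ o → Dec (Step o₁ o₂ o)
step? o₁ o₂ o =
  (label (right o₁) ≟ label (left o₂)) ×-dec
  ¬? (label (right o₁) ≟ none) ×-dec
  (demand (label (right o₁)) ⊑? fuse (right o₁) (left o₂)) ×-dec
  (left o ⊑? extend (left o₁) (label (right o₂))) ×-dec
  (right o ⊑? extend (right o₂) (label (left o₁))) ×-dec
  (slack o + 6 + 2 * exc (label (right o₁)) ≤? slack o₁ + slack o₂ + sel (label (right o₁)))

joins? : ∀ p q r → Dec (Joins p q r)
joins? p q r = (4 ⊓ (size p + size q) ≤? size r) ×-dec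
  All.all? (λ o → Any.any? (λ o₁ → Any.any? (λ o₂ → step? o₁ o₂ o) (options q)) (options p)) (options r)

side? : ∀ o → Dec (Side o)
side? o = ¬? (label (left o) ≟ none) ×-dec ¬? (label (right o) ≟ none) ×-dec
  (left o ⊑? _) ×-dec (right o ⊑? _) ×-dec (_ ≤? _)

complete? : ∀ o → Dec (Complete o)
complete? o = ¬? (label (left o) ≟ none) ×-dec ¬? (label (right o) ≟ none) ×-dec
  (_ ⊑? left o) ×-dec (_ ⊑? right o) ×-dec (6 ≤? slack o)

-- Found by computer search: a closed family, then thinned out.  The first profile is that of a single
-- edge, those of sizes 2 and 3 are those of a triangle and of the two triangulated quadrilaterals.
profiles : List Profile
profiles =
  profile 1 (
    option (clean ⟨ 0 , 1 ⟩) (out ⟨ 1 , 1 ⟩) 7 ∷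
    option (clean ⟨ 1 , 1 ⟩) (clean ⟨ 1 , 1 ⟩) 4 ∷
    option (clean ⟨ 2 , 1 ⟩) (dirty ⟨ 1 , 1 ⟩) 4 ∷
    option (dirty ⟨ 0 , 1 ⟩) (out ⟨ 2 , 0 ⟩) 7 ∷
    option (dirty ⟨ 1 , 1 ⟩) (clean ⟨ 2 , 1 ⟩) 4 ∷
    option (dirty ⟨ 2 , 1 ⟩) (dirty ⟨ 2 , 1 ⟩) 4 ∷
    option (out ⟨ 0 , 0 ⟩) (out ⟨ 0 , 0 ⟩) 10 ∷
    option (out ⟨ 2 , 0 ⟩) (dirty ⟨ 0 , 1 ⟩) 7 ∷
    option (out ⟨ 1 , 1 ⟩) (clean ⟨ 0 , 1 ⟩) 7 ∷ []) ∷
  profile 2 (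
    option (clean ⟨ 1 , 2 ⟩) (clean ⟨ 1 , 2 ⟩) 6 ∷
    option (clean ⟨ 2 , 2 ⟩) (dirty ⟨ 1 , 2 ⟩) 6 ∷
    option (dirty ⟨ 1 , 2 ⟩) (clean ⟨ 2 , 2 ⟩) 6 ∷ []) ∷
  profile 3 (
    option (clean ⟨ 2 , 2 ⟩) (clean ⟨ 2 , 3 ⟩) 5 ∷
    option (clean ⟨ 2 , 2 ⟩) (dirty ⟨ 2 , 3 ⟩) 5 ∷
    option (dirty ⟨ 2 , 2 ⟩) (clean ⟨ 2 , 3 ⟩) 5 ∷
    option (dirty ⟨ 2 , 2 ⟩) (dirty ⟨ 2 , 3 ⟩) 5 ∷
    option (out ⟨ 2 , 1 ⟩) (dirty ⟨ 1 , 3 ⟩) 8 ∷ []) ∷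
  profile 3 (
    option (clean ⟨ 2 , 3 ⟩) (clean ⟨ 2 , 2 ⟩) 5 ∷
    option (clean ⟨ 2 , 3 ⟩) (dirty ⟨ 2 , 2 ⟩) 5 ∷
    option (dirty ⟨ 1 , 3 ⟩) (out ⟨ 2 , 1 ⟩) 8 ∷
    option (dirty ⟨ 2 , 3 ⟩) (clean ⟨ 2 , 2 ⟩) 5 ∷
    option (dirty ⟨ 2 , 3 ⟩) (dirty ⟨ 2 , 2 ⟩) 5 ∷ []) ∷
  profile 4 (
    option (clean ⟨ 2 , 2 ⟩) (clean ⟨ 2 , 3 ⟩) 4 ∷
    option (clean ⟨ 2 , 2 ⟩) (dirty ⟨ 2 , 3 ⟩) 7 ∷
    option (dirty ⟨ 2 , 2 ⟩) (clean ⟨ 2 , 3 ⟩) 4 ∷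
    option (dirty ⟨ 2 , 2 ⟩) (dirty ⟨ 2 , 3 ⟩) 7 ∷
    option (out ⟨ 2 , 0 ⟩) (dirty ⟨ 1 , 3 ⟩) 5 ∷
    option (out ⟨ 2 , 1 ⟩) (clean ⟨ 2 , 3 ⟩) 7 ∷ []) ∷
  profile 4 (
    option (clean ⟨ 2 , 2 ⟩) (dirty ⟨ 2 , 3 ⟩) 4 ∷
    option (clean ⟨ 2 , 2 ⟩) (out ⟨ 2 , 1 ⟩) 7 ∷
    option (dirty ⟨ 2 , 2 ⟩) (clean ⟨ 2 , 3 ⟩) 4 ∷
    option (dirty ⟨ 2 , 2 ⟩) (dirty ⟨ 2 , 3 ⟩) 4 ∷
    option (dirty ⟨ 2 , 2 ⟩) (out ⟨ 2 , 1 ⟩) 7 ∷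
    option (out ⟨ 2 , 1 ⟩) (clean ⟨ 2 , 3 ⟩) 7 ∷
    option (out ⟨ 2 , 1 ⟩) (dirty ⟨ 2 , 3 ⟩) 7 ∷ []) ∷
  profile 4 (
    option (clean ⟨ 2 , 3 ⟩) (clean ⟨ 2 , 3 ⟩) 5 ∷
    option (clean ⟨ 2 , 3 ⟩) (dirty ⟨ 2 , 3 ⟩) 6 ∷
    option (dirty ⟨ 2 , 3 ⟩) (clean ⟨ 2 , 3 ⟩) 6 ∷ []) ∷
  profile 4 (
    option (clean ⟨ 2 , 3 ⟩) (dirty ⟨ 2 , 2 ⟩) 4 ∷
    option (clean ⟨ 2 , 3 ⟩) (out ⟨ 2 , 1 ⟩) 7 ∷
    option (dirty ⟨ 2 , 3 ⟩) (clean ⟨ 2 , 2 ⟩) 4 ∷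
    option (dirty ⟨ 2 , 3 ⟩) (dirty ⟨ 2 , 2 ⟩) 4 ∷
    option (dirty ⟨ 2 , 3 ⟩) (out ⟨ 2 , 1 ⟩) 7 ∷
    option (out ⟨ 2 , 1 ⟩) (clean ⟨ 2 , 2 ⟩) 7 ∷
    option (out ⟨ 2 , 1 ⟩) (dirty ⟨ 2 , 2 ⟩) 7 ∷ []) ∷
  profile 4 (
    option (clean ⟨ 2 , 2 ⟩) (clean ⟨ 2 , 3 ⟩) 5 ∷
    option (dirty ⟨ 2 , 2 ⟩) (clean ⟨ 2 , 3 ⟩) 5 ∷
    option (dirty ⟨ 2 , 2 ⟩) (dirty ⟨ 2 , 3 ⟩) 5 ∷
    option (out ⟨ 2 , 1 ⟩) (clean ⟨ 2 , 3 ⟩) 6 ∷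
    option (out ⟨ 2 , 1 ⟩) (dirty ⟨ 1 , 3 ⟩) 8 ∷ []) ∷
  profile 4 (
    option (clean ⟨ 2 , 3 ⟩) (dirty ⟨ 2 , 2 ⟩) 4 ∷
    option (clean ⟨ 2 , 3 ⟩) (out ⟨ 1 , 1 ⟩) 7 ∷
    option (dirty ⟨ 2 , 3 ⟩) (clean ⟨ 2 , 2 ⟩) 7 ∷
    option (dirty ⟨ 2 , 3 ⟩) (dirty ⟨ 2 , 2 ⟩) 7 ∷
    option (dirty ⟨ 2 , 3 ⟩) (out ⟨ 2 , 1 ⟩) 6 ∷ []) ∷
  profile 4 (
    option (clean ⟨ 2 , 3 ⟩) (clean ⟨ 2 , 3 ⟩) 5 ∷
    option (dirty ⟨ 2 , 3 ⟩) (clean ⟨ 2 , 3 ⟩) 5 ∷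
    option (dirty ⟨ 2 , 3 ⟩) (dirty ⟨ 2 , 3 ⟩) 8 ∷ []) ∷
  profile 4 (
    option (clean ⟨ 2 , 3 ⟩) (clean ⟨ 2 , 2 ⟩) 5 ∷
    option (clean ⟨ 2 , 3 ⟩) (dirty ⟨ 2 , 2 ⟩) 5 ∷
    option (dirty ⟨ 2 , 3 ⟩) (clean ⟨ 2 , 2 ⟩) 4 ∷
    option (dirty ⟨ 2 , 3 ⟩) (dirty ⟨ 2 , 2 ⟩) 5 ∷
    option (dirty ⟨ 2 , 3 ⟩) (out ⟨ 2 , 1 ⟩) 8 ∷ []) ∷
  profile 4 (
    option (clean ⟨ 1 , 2 ⟩) (clean ⟨ 2 , 3 ⟩) 5 ∷
    option (clean ⟨ 2 , 2 ⟩) (dirty ⟨ 2 , 3 ⟩) 6 ∷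
    option (dirty ⟨ 1 , 2 ⟩) (clean ⟨ 2 , 3 ⟩) 6 ∷
    option (out ⟨ 2 , 1 ⟩) (dirty ⟨ 2 , 3 ⟩) 6 ∷ []) ∷
  profile 4 (
    option (clean ⟨ 2 , 3 ⟩) (clean ⟨ 2 , 2 ⟩) 5 ∷
    option (clean ⟨ 2 , 3 ⟩) (dirty ⟨ 2 , 2 ⟩) 5 ∷
    option (clean ⟨ 2 , 3 ⟩) (out ⟨ 2 , 1 ⟩) 7 ∷
    option (dirty ⟨ 1 , 3 ⟩) (out ⟨ 2 , 1 ⟩) 8 ∷
    option (dirty ⟨ 2 , 3 ⟩) (dirty ⟨ 2 , 2 ⟩) 5 ∷ []) ∷
  profile 4 (
    option (clean ⟨ 2 , 3 ⟩) (clean ⟨ 2 , 3 ⟩) 4 ∷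
    option (clean ⟨ 2 , 3 ⟩) (dirty ⟨ 2 , 3 ⟩) 7 ∷
    option (dirty ⟨ 2 , 3 ⟩) (clean ⟨ 2 , 3 ⟩) 7 ∷ []) ∷
  profile 4 (
    option (clean ⟨ 2 , 3 ⟩) (clean ⟨ 1 , 2 ⟩) 5 ∷
    option (clean ⟨ 2 , 3 ⟩) (dirty ⟨ 1 , 2 ⟩) 6 ∷
    option (clean ⟨ 2 , 3 ⟩) (out ⟨ 2 , 1 ⟩) 6 ∷
    option (dirty ⟨ 2 , 3 ⟩) (clean ⟨ 2 , 2 ⟩) 6 ∷ []) ∷
  profile 4 (
    option (clean ⟨ 2 , 2 ⟩) (clean ⟨ 2 , 3 ⟩) 5 ∷
    option (dirty ⟨ 2 , 2 ⟩) (clean ⟨ 2 , 3 ⟩) 5 ∷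
    option (dirty ⟨ 2 , 2 ⟩) (dirty ⟨ 2 , 3 ⟩) 5 ∷
    option (out ⟨ 2 , 1 ⟩) (dirty ⟨ 2 , 3 ⟩) 8 ∷ []) ∷ []

Closed : List Profile → Set
Closed ps = All (λ p → All (λ q → Any (Joins p q) ps) ps) ps

-- The pairs are ordered, because `p` sits at ik and `q` at kj. This is the induction step of
-- `realise`, reduced to a finite computation.
profiles-closed : Closed profiles
profiles-closed = toWitness {a? = All.all? (λ p → All.all? (λ q → Any.any? (joins? p q) profiles) profiles) profiles} tt

profiles-side : Any (λ p → 1 ≤ size p × All Side (options p)) profiles
profiles-side = toWitness {a? = Any.any? (λ p → (1 ≤? size p) ×-dec All.all? side? (options p)) profiles} tt

profiles-complete : All (λ p → 4 ≤ size p → Any Complete (options p)) profiles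
profiles-complete = toWitness {a? = All.all? (λ p → (4 ≤? size p) →-dec Any.any? complete? (options p)) profiles} tt

-- Maximal outerplanar graphs

maximum : ∀ {n} {P : Fin n → Set} → (∀ x → Dec (P x)) → (f : Fin n → ℕ) → ∃ P →
  ∃ λ x → P x × ∀ y → P y → f y ≤ f x
maximum {n} P? f (x₀ , Px₀) =
  -- The default value `x₀` satisfies `P` itself, so the result does in every case.
  argmax f x₀ xs , argmax-all f Px₀ (all-filter P? (allFin n)) ,
  λ y Py → All.lookup (f[xs]≤f[argmax] x₀ xs) (∈-filter⁺ P? (∈-allFin y) Py)
  where xs = filter P? (allFin n)

minimum : ∀ {n} {P : Fin n → Set} → (∀ x → Dec (P x)) → (f : Fin n → ℕ) → ∃ P →
  ∃ λ x → P x × ∀ y → P y → f x ≤ f y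
minimum {n} P? f (x₀ , Px₀) =
  argmin f x₀ xs , argmin-all f Px₀ (all-filter P? (allFin n)) ,
  λ y Py → All.lookup (f[argmin]≤f[xs] x₀ xs) (∈-filter⁺ P? (∈-allFin y) Py)
  where xs = filter P? (allFin n)

Crosses-sym : ∀ {a b c d} → Crosses a b c d → Crosses c d a b
Crosses-sym (inj₁ p)                                           = inj₂ (inj₂ (inj₂ (inj₂ (inj₁ p))))
Crosses-sym (inj₂ (inj₁ p))                                    = inj₂ (inj₂ (inj₂ (inj₂ (inj₂ (inj₁ p)))))
Crosses-sym (inj₂ (inj₂ (inj₁ p)))                             = inj₂ (inj₂ (inj₂ (inj₂ (inj₂ (inj₂ (inj₁ p))))))
Crosses-sym (inj₂ (inj₂ (inj₂ (inj₁ p))))                      = inj₂ (inj₂ (inj₂ (inj₂ (inj₂ (inj₂ (inj₂ p))))))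
Crosses-sym (inj₂ (inj₂ (inj₂ (inj₂ (inj₁ p)))))               = inj₁ p
Crosses-sym (inj₂ (inj₂ (inj₂ (inj₂ (inj₂ (inj₁ p))))))        = inj₂ (inj₁ p)
Crosses-sym (inj₂ (inj₂ (inj₂ (inj₂ (inj₂ (inj₂ (inj₁ p))))))) = inj₂ (inj₂ (inj₁ p))
Crosses-sym (inj₂ (inj₂ (inj₂ (inj₂ (inj₂ (inj₂ (inj₂ p))))))) = inj₂ (inj₂ (inj₂ (inj₁ p)))

Crosses-flip : ∀ {a b c d} → Crosses a b c d → Crosses b a c d
Crosses-flip (inj₁ p)                                           = inj₂ (inj₁ p)
Crosses-flip (inj₂ (inj₁ p))                                    = inj₁ p
Crosses-flip (inj₂ (inj₂ (inj₁ p)))                             = inj₂ (inj₂ (inj₂ (inj₁ p)))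
Crosses-flip (inj₂ (inj₂ (inj₂ (inj₁ p))))                      = inj₂ (inj₂ (inj₁ p))
Crosses-flip (inj₂ (inj₂ (inj₂ (inj₂ (inj₁ p)))))               = inj₂ (inj₂ (inj₂ (inj₂ (inj₂ (inj₂ (inj₁ p))))))
Crosses-flip (inj₂ (inj₂ (inj₂ (inj₂ (inj₂ (inj₁ p))))))        = inj₂ (inj₂ (inj₂ (inj₂ (inj₂ (inj₂ (inj₂ p))))))
Crosses-flip (inj₂ (inj₂ (inj₂ (inj₂ (inj₂ (inj₂ (inj₁ p))))))) = inj₂ (inj₂ (inj₂ (inj₂ (inj₁ p))))
Crosses-flip (inj₂ (inj₂ (inj₂ (inj₂ (inj₂ (inj₂ (inj₂ p))))))) = inj₂ (inj₂ (inj₂ (inj₂ (inj₂ (inj₁ p)))))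

-- Crossing of the chords ab and cd for a < b, with c the end inside and d the end outside. This
-- reduces the eight cases of `Crosses` to two.
Separates : ℕ → ℕ → ℕ → ℕ → Set
Separates a b c d = (a < c × c < b) × (d < a ⊎ b < d)

Crosses⇒Separates : ∀ {a b c d} → a < b → Crosses a b c d → Separates a b c d ⊎ Separates a b d c
Crosses⇒Separates a<b (inj₁ (p , q , r))               = inj₁ ((p , q) , inj₂ r)
Crosses⇒Separates a<b (inj₂ (inj₁ (p , q , r)))        = contradiction (<-trans p q) (<-asym a<b)
Crosses⇒Separates a<b (inj₂ (inj₂ (inj₁ (p , q , r)))) = inj₂ ((p , q) , inj₂ r)
Crosses⇒Separates a<b (inj₂ (inj₂ (inj₂ (inj₁ (p , q , r))))) =
  contradiction (<-trans p q) (<-asym a<b)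
Crosses⇒Separates a<b (inj₂ (inj₂ (inj₂ (inj₂ (inj₁ (p , q , r)))))) = inj₂ ((q , r) , inj₁ p)
Crosses⇒Separates a<b (inj₂ (inj₂ (inj₂ (inj₂ (inj₂ (inj₁ (p , q , r))))))) = inj₁ ((q , r) , inj₁ p)
Crosses⇒Separates a<b (inj₂ (inj₂ (inj₂ (inj₂ (inj₂ (inj₂ (inj₁ (p , q , r)))))))) =
  contradiction (<-trans q r) (<-asym a<b)
Crosses⇒Separates a<b (inj₂ (inj₂ (inj₂ (inj₂ (inj₂ (inj₂ (inj₂ (p , q , r)))))))) =
  contradiction (<-trans q r) (<-asym a<b)

Separates⇒Crosses : ∀ {a b c d} → Separates a b c d → Crosses a b c d
Separates⇒Crosses ((p , q) , inj₂ r) = inj₁ (p , q , r)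
Separates⇒Crosses ((p , q) , inj₁ r) = inj₂ (inj₂ (inj₂ (inj₂ (inj₂ (inj₁ (r , p , q))))))

module _ {n : ℕ} {E : Adj n} (symmetric : ∀ u v → E u v ≡ E v u) where

  NewEdge : (u v x y : Fin n) → Set
  NewEdge u v x y = E x y ≡ true ⊎ (x ≡ u × y ≡ v) ⊎ (x ≡ v × y ≡ u)

  addEdge-true : ∀ u v x y → addEdge E u v x y ≡ true → NewEdge u v x y
  addEdge-true u v x y p with E x y
  ... | true = inj₁ refl
  ... | false with x ≟ u | y ≟ v | x ≟ v | y ≟ u
  ...   | yes a | yes b | _     | _     = inj₂ (inj₁ (a , b))
  ...   | yes _ | no _  | yes a | yes b = inj₂ (inj₂ (a , b))
  ...   | no _  | _     | yes a | yes b = inj₂ (inj₂ (a , b))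

  NewEdge-sym : ∀ {u v x y} → NewEdge u v x y → NewEdge u v y x
  NewEdge-sym (inj₁ e)              = inj₁ (trans (symmetric _ _) e)
  NewEdge-sym (inj₂ (inj₁ (a , b))) = inj₂ (inj₂ (b , a))
  NewEdge-sym (inj₂ (inj₂ (a , b))) = inj₂ (inj₁ (b , a))

  module Maximal (pos : Fin n → Fin n) (injective : Injective _≡_ _≡_ pos)
    (noncrossing : ∀ a b c d → E a b ≡ true → E c d ≡ true →
      ¬ Crosses (toℕ (pos a)) (toℕ (pos b)) (toℕ (pos c)) (toℕ (pos d)))
    (maximal : ∀ u v → u ≢ v → E u v ≡ false → ¬ Outerplanar (addEdge E u v)) where

    rank : Fin n → ℕ
    rank = toℕ ∘ pos

    rank-injective : ∀ {x y} → rank x ≡ rank y → x ≡ y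
    rank-injective = injective ∘ toℕ-injective

    Separated : (u v c d : Fin n) → Set
    Separated u v c d = Separates (rank u) (rank v) (rank c) (rank d)

    unseparated : ∀ {u v c d} → E u v ≡ true → E c d ≡ true → ¬ Separated u v c d
    unseparated e e′ s = noncrossing _ _ _ _ e e′ (Separates⇒Crosses s)

    -- Otherwise uv could be drawn as a further chord with the same `pos`, against maximality.
    adjacent : ∀ {u v} → rank u < rank v → (∀ c d → E c d ≡ true → ¬ Separated u v c d) → E u v ≡ true
    adjacent {u} {v} u<v unsep with E u v in eq
    ... | true  = refl
    ... | false = ⊥-elim (maximal u v (λ { refl → <-irrefl refl u<v }) eq (pos , injective , λ a b c d p q →
                    new (addEdge-true u v a b p) (addEdge-true u v c d q)))
      where
      unsep′ : ∀ {c d} → NewEdge u v c d → ¬ Separated u v c d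
      unsep′ (inj₁ e) s                               = unsep _ _ e s
      unsep′ (inj₂ (inj₁ (refl , _))) ((u<u , _) , _) = <-irrefl refl u<u
      unsep′ (inj₂ (inj₂ (refl , _))) ((_ , v<v) , _) = <-irrefl refl v<v
      uncrossed : ∀ {c d} → NewEdge u v c d → ¬ Crosses (rank u) (rank v) (rank c) (rank d)
      uncrossed e cr with Crosses⇒Separates u<v cr
      ... | inj₁ s = unsep′ e s
      ... | inj₂ s = unsep′ (NewEdge-sym e) s
      new : ∀ {a b c d} → NewEdge u v a b → NewEdge u v c d →
        ¬ Crosses (rank a) (rank b) (rank c) (rank d)
      new (inj₂ (inj₁ (refl , refl))) e′ cr = uncrossed e′ cr
      new (inj₂ (inj₂ (refl , refl))) e′ cr = uncrossed e′ (Crosses-flip cr)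
      new e (inj₂ (inj₁ (refl , refl))) cr = uncrossed e (Crosses-sym cr)
      new e (inj₂ (inj₂ (refl , refl))) cr = uncrossed e (Crosses-flip (Crosses-sym cr))
      new (inj₁ e) (inj₁ e′) cr = noncrossing _ _ _ _ e e′ cr

    Between : (i j x : Fin n) → Set
    Between i j x = rank i < rank x × rank x < rank j

    between? : ∀ i j x → Dec (Between i j x)
    between? i j x = (rank i <? rank x) ×-dec (rank x <? rank j)

    -- The third vertex of the triangle on the inner side of the edge ij is the last neighbour of i before j.
    apex : ∀ {i j} → E i j ≡ true → ∃ (Between i j) →
      ∃ λ k → Between i j k × E i k ≡ true × E k j ≡ true
    apex {i} {j} ij between =
      -- The vertex s comes right after i, so no edge can have an end strictly between them and `is`
      -- is an edge. Hence i has some neighbour before j, and a last one exists.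
      let s , (i<s , s<j) , first = minimum (between? i j) rank between
          is = adjacent i<s λ { c d _ ((i<c , c<s) , _) → <⇒≱ c<s (first c (i<c , <-trans c<s s<j)) }
          k , ((i<k , k<j) , ik) , last =
            maximum (λ x → between? i j x ×-dec (E i x ≟ᵇ true)) rank (s , (i<s , s<j) , is)
          -- An edge from strictly between k and j to the outside crosses ij or ik, unless it ends
          -- at i; then i has a neighbour after k and before j, and k was not the last.
          kj = adjacent k<j λ c d cd sep → separated i<k ik last c d cd sep
      in k , (i<k , k<j) , ik , kj
      where
      separated : ∀ {k} → rank i < rank k → E i k ≡ true →
        (∀ y → Between i j y × E i y ≡ true → rank y ≤ rank k) →
        ∀ c d → E c d ≡ true → ¬ Separated k j c d
      separated i<k ik last c d cd ((k<c , c<j) , inj₂ j<d) =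
        unseparated ij cd ((<-trans i<k k<c , c<j) , inj₂ j<d)
      separated i<k ik last c d cd ((k<c , c<j) , inj₁ d<k) with <-cmp (rank d) (rank i)
      ... | tri< d<i _ _ = unseparated ij cd ((<-trans i<k k<c , c<j) , inj₁ d<i)
      ... | tri> _ _ i<d = unseparated ik (trans (symmetric d c) cd) ((i<d , d<k) , inj₂ k<c)
      ... | tri≈ _ d≡i _ with rank-injective d≡i
      ...   | refl = <⇒≱ k<c (last c ((<-trans i<k k<c , c<j) , trans (symmetric d c) cd))

    -- The fuel `m` bounds the rank distance from i to j, and both edges at the apex span a strictly
    -- smaller distance.
    triangulate : ∀ m {i j} → rank j ≤ m + rank i → rank i < rank j → E i j ≡ true → Triangulated E rank i j
    triangulate zero    j≤i  i<j ij = contradiction j≤i (<⇒≱ i<j)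
    triangulate (suc m) {i} {j} fuel i<j ij with any? (between? i j)
    ... | no empty = side i<j (λ x i<x x<j → empty (x , i<x , x<j)) ij
    ... | yes between =
      let k , (i<k , k<j) , ik , kj = apex ij between
      in triangle k i<k k<j ij
        (triangulate m (≤-pred (≤-trans k<j fuel)) i<k ik)
        (triangulate m (≤-trans fuel (≤-trans (≤-reflexive (sym (+-suc m (rank i)))) (+-monoʳ-≤ m i<k))) k<j kj)

    -- The vertices of least and greatest rank are adjacent, as nothing lies outside them that a
    -- separating edge could reach.
    outerEdge : ∀ {a b : Fin n} → a ≢ b → ∃₂ λ i j → rank i < rank j × E i j ≡ true ×
      (∀ x → rank i ≤ rank x) × (∀ x → rank x ≤ rank j)
    outerEdge {a} {b} a≢b =
      let i , _ , first = minimum (λ _ → yes tt) rank (a , tt)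
          j , _ , last  = maximum (λ _ → yes tt) rank (a , tt)
          -- If the extreme ranks coincided, a and b would have the same rank.
          i<j = ≤∧≢⇒< (first j tt) λ eq → a≢b (rank-injective (trans
            (≤-antisym (subst (rank a ≤_) (sym eq) (last a tt)) (first a tt))
            (≤-antisym (first b tt) (subst (rank b ≤_) (sym eq) (last b tt)))))
      in i , j , i<j ,
         adjacent i<j (λ { c d _ (_ , inj₁ d<i) → <⇒≱ d<i (first d tt)
                         ; c d _ (_ , inj₂ j<d) → <⇒≱ j<d (last d tt) }) ,
         (λ x → first x tt) , (λ x → last x tt)

-- Counting vertices and realising profiles

⊓-+-mono : ∀ k {a b c d} → k ⊓ a ≤ c → k ⊓ b ≤ d → k ⊓ (a + b) ≤ k ⊓ (c + d)
⊓-+-mono k {a} {b} {c} {d} p q = ⊓-glb (m⊓n≤m k (a + b)) (≤-trans subadditive (+-mono-≤ p q))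
  where
  subadditive : k ⊓ (a + b) ≤ k ⊓ a + k ⊓ b
  subadditive with ≤-total k a | ≤-total k b
  ... | inj₁ k≤a | _ rewrite m≤n⇒m⊓n≡m k≤a = ≤-trans (m⊓n≤m k (a + b)) (m≤m+n k (k ⊓ b))
  ... | inj₂ _ | inj₁ k≤b rewrite m≤n⇒m⊓n≡m k≤b = ≤-trans (m⊓n≤m k (a + b)) (m≤n+m k (k ⊓ a))
  ... | inj₂ a≤k | inj₂ b≤k rewrite m≥n⇒m⊓n≡n a≤k | m≥n⇒m⊓n≡n b≤k = m⊓n≤n k (a + b)

-- Mapping x to the index of an occurrence is injective, since looking that index up returns x.
length-cover : ∀ {n} {xs : List (Fin n)} → (∀ x → x ∈ˡ xs) → n ≤ length xs
length-cover {xs = xs} cover = injective⇒≤ {f = λ x → Any.index (cover x)} λ {x} {y} eq →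
  trans (lookup-index (cover x)) (trans (cong (lookupˡ xs) eq) (sym (lookup-index (cover y))))

module _ {n : ℕ} {E : Adj n} {rank : Fin n → ℕ} where

  edge : ∀ {i j} → Triangulated E rank i j → E i j ≡ true
  edge (side _ _ e)           = e
  edge (triangle _ _ _ e _ _) = e

  inner : ∀ {i j} → Triangulated E rank i j → List (Fin n)
  inner (side _ _ _)           = []
  inner (triangle k _ _ _ s t) = k ∷ inner s ++ inner t

  -- A binary tree has one leaf more than it has branch nodes, and each branch node contributes its
  -- apex.
  length-inner : ∀ {i j} (t : Triangulated E rank i j) → suc (length (inner t)) ≡ sides E rank t
  length-inner (side _ _ _)           = refl
  length-inner (triangle k _ _ _ s t) = begin
    suc (suc (length (inner s ++ inner t)))           ≡⟨ cong (2 +_) (length-++ (inner s)) ⟩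
    suc (suc (length (inner s) + length (inner t)))   ≡⟨ cong suc (+-suc (length (inner s)) (length (inner t))) ⟨
    suc (length (inner s)) + suc (length (inner t))   ≡⟨ cong₂ _+_ (length-inner s) (length-inner t) ⟩
    sides E rank s + sides E rank t                   ∎
    where open ≡-Reasoning

  1≤sides : ∀ {i j} (t : Triangulated E rank i j) → 1 ≤ sides E rank t
  1≤sides t = subst (1 ≤_) (length-inner t) (s≤s z≤n)

  module _ (rank-injective : ∀ {x y} → rank x ≡ rank y → x ≡ y) where

    inner-complete : ∀ {i j} (t : Triangulated E rank i j) →
      ∀ x → rank i < rank x → rank x < rank j → x ∈ˡ inner t
    inner-complete (side _ empty _) x i<x x<j = ⊥-elim (empty x i<x x<j)
    inner-complete (triangle k _ _ _ s t) x i<x x<j with <-cmp (rank x) (rank k)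
    ... | tri< x<k _ _ = there (∈-++⁺ˡ (inner-complete s x i<x x<k))
    ... | tri≈ _ x≡k _ = here (rank-injective x≡k)
    ... | tri> _ _ k<x = there (∈-++⁺ʳ (inner s) (inner-complete t x k<x x<j))

    covering : ∀ {i j} → (∀ x → rank i ≤ rank x) → (∀ x → rank x ≤ rank j) →
      (t : Triangulated E rank i j) → ∀ x → x ∈ˡ i ∷ j ∷ inner t
    covering {i} {j} first last t x with <-cmp (rank i) (rank x) | <-cmp (rank x) (rank j)
    ... | tri> _ _ x<i | _            = contradiction (first x) (<⇒≱ x<i)
    ... | tri≈ _ i≡x _ | _            = here (sym (rank-injective i≡x))
    ... | tri< _ _ _   | tri> _ _ j<x = contradiction (last x) (<⇒≱ j<x)
    ... | tri< _ _ _   | tri≈ _ x≡j _ = there (here (rank-injective x≡j))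
    ... | tri< i<x _ _ | tri< x<j _ _ = there (there (inner-complete t x i<x x<j))

    module _ (symmetric : ∀ u v → E u v ≡ E v u) (loopless : ∀ u → E u u ≡ false) where

      -- Induction on the triangulation. All options of one profile are realised together, because
      -- different options of the glued polygon may draw on different options of its halves.
      realise : ∀ {i j} (t : Triangulated E rank i j) → ∃ λ p → p ∈ˡ profiles ×
        4 ⊓ sides E rank t ≤ size p × All (Realised E rank i j) (options p)
      realise (side i<j empty e) =
        let p , p∈ , 1≤p , s = find profiles-side
        in p , p∈ , 1≤p , All.map (realise-side E rank symmetric loopless rank-injective i<j empty e) s
      realise (triangle k i<k k<j e s t) =
        let p , p∈ , ≤p , ps = realise s
            q , q∈ , ≤q , qs = realise t
            r , r∈ , ≤r , js = find (All.lookup (All.lookup profiles-closed p∈) q∈)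
        in r , r∈ , ≤-trans (⊓-+-mono 4 ≤p ≤q) ≤r ,
           All.map (λ j →
             let P , j′ = All.lookupAny ps j
                 Q , st = All.lookupAny qs j′
             in realise-triangle E rank symmetric loopless rank-injective i<k k<j e st P Q) js

-- From triangulations to secure total dominating sets

Goal : ∀ {n} → Adj n → Set
Goal {n} E = ∃ λ (S : Subset n) → SecureTotalDominating E S × ∣ S ∣ ≤ (2 * n) / 3 ×
  (∀ (v : Fin n) → v ∈ S → degree E v ≢ 2)

module _ {n : ℕ} {E : Adj n} {rank : Fin n → ℕ} (rank-injective : ∀ {x y} → rank x ≡ rank y → x ≡ y) where

  -- Every vertex is i, j or strictly between them, so completeness at the two ends settles the
  -- whole graph.
  realised⇒goal : ∀ {i j} → (∀ x → rank i ≤ rank x) → (∀ x → rank x ≤ rank j) →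
    ∀ {o} → Complete o → Realised E rank i j o → Goal E
  realised⇒goal {i} {j} first last {o} (l≢none , m≢none , dˡ , dʳ , 6≤) r =
    chosen E labelling , secure , ∣chosen∣≤2n/3 s≤2e , degree≢2
    where
    open Realised r
    everywhere : ∀ x → Settled E labelling x
    everywhere x with <-cmp (rank i) (rank x) | <-cmp (rank x) (rank j)
    ... | tri> _ _ x<i | _            = contradiction (first x) (<⇒≱ x<i)
    ... | tri< _ _ _   | tri> _ _ j<x = contradiction (last x) (<⇒≱ j<x)
    ... | tri< i<x _ _ | tri< x<j _ _ = settled x i<x x<j
    ... | tri< _ _ _   | tri≈ _ x≡j _ with rank-injective x≡j
    ...   | refl = settle E {e = right o} m≢none dʳ meets-right
    everywhere x | tri≈ _ i≡x _ | _ with rank-injective i≡x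
    ...   | refl = settle E {e = left o} l≢none dˡ meets-left
    open Sufficient E labelling everywhere
    s≤2e : ∑ (sel ∘ labelling) ≤ 2 * ∑ (exc ∘ labelling)
    s≤2e = +-cancelʳ-≤ 6 _ _ (≤-trans (+-monoʳ-≤ (∑ (sel ∘ labelling)) 6≤) balance)

-- For n = 4 the graph is K₄ minus an edge; the two vertices of degree 3 form S.
module Diamond {n : ℕ} {E : Adj n} (symmetric : ∀ u v → E u v ≡ E v u) (loopless : ∀ u → E u u ≡ false)
  (4≤n : 4 ≤ n) {a b u w : Fin n}
  (ab : E a b ≡ true) (au : E a u ≡ true) (bu : E b u ≡ true) (aw : E a w ≡ true) (bw : E b w ≡ true)
  (u≢w : u ≢ w) (all : ∀ x → x ≡ a ⊎ x ≡ b ⊎ x ≡ u ⊎ x ≡ w) where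

  isCentre : Fin n → Bool
  isCentre x = does (x ≟ a) ∨ does (x ≟ b)

  S : Subset n
  S = tabulate isCentre

  ∈S : ∀ {x} → isCentre x ≡ true → x ∈ S
  ∈S {x} p = lookup⇒[]= x S (trans (lookup∘tabulate isCentre x) p)

  S∈ : ∀ {x} → x ∈ S → x ≡ a ⊎ x ≡ b
  S∈ {x} x∈ with x ≟ a | x ≟ b | trans (sym (lookup∘tabulate isCentre x)) ([]=⇒lookup x∈)
  ... | yes x≡a | _       | _ = inj₁ x≡a
  ... | no _    | yes x≡b | _ = inj₂ x≡b

  a∈S : a ∈ S
  a∈S = ∈S (cong (_∨ does (a ≟ b)) (dec-true (a ≟ a) refl))

  b∈S : b ∈ S
  b∈S = ∈S (trans (cong (does (b ≟ a) ∨_) (dec-true (b ≟ b) refl)) (∨-zeroʳ _))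

  ∣S∣≤2 : ∣ S ∣ ≤ 2
  ∣S∣≤2 = begin
    ∣ S ∣                            ≡⟨ ∣tabulate∣ isCentre ⟩
    ∑ (bit ∘ isCentre)               ≤⟨ ∑-mono pointwise ⟩
    ∑ (λ x → δ a 1 x + δ b 1 x)      ≡⟨ ∑-distrib-+ (δ a 1) (δ b 1) ⟩
    ∑ (δ a 1) + ∑ (δ b 1)            ≡⟨ cong₂ _+_ (∑-δ a 1) (∑-δ b 1) ⟩
    2                                ∎
    where
    open ≤-Reasoning
    pointwise : ∀ x → bit (isCentre x) ≤ δ a 1 x + δ b 1 x
    pointwise x with x ≟ a | x ≟ b
    ... | yes _ | _     = s≤s z≤n
    ... | no _  | yes _ = ≤-refl
    ... | no _  | no _  = z≤n

  adjacent⇒≢ : ∀ {x y} → E x y ≡ true → x ≢ y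
  adjacent⇒≢ {x} e refl with trans (sym e) (loopless x)
  ... | ()

  flip : ∀ {x y} → E x y ≡ true → E y x ≡ true
  flip {x} {y} e = trans (symmetric y x) e

  -- The centre b dominates all vertices but itself, and z dominates b. With z = a this treats `S`,
  -- with z an outer vertex the set after a has been exchanged for it.
  dominating : ∀ {T z} → b ∈ T → z ∈ T → E b z ≡ true → TotalDominating E T
  dominating {T} {z} b∈ z∈ bz x with all x
  ... | inj₁ refl                = b , b∈ , ab
  ... | inj₂ (inj₁ refl)         = z , z∈ , bz
  ... | inj₂ (inj₂ (inj₁ refl))  = b , b∈ , flip bu
  ... | inj₂ (inj₂ (inj₂ refl))  = b , b∈ , flip bw

  swapped : ∀ {z} → E b z ≡ true → TotalDominating E (swap S a z)
  swapped {z} bz = dominating (∈-swap E b∈S (adjacent⇒≢ (flip ab))) ([]≔-updates (S [ a ]≔ _) z) bz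

  secure : SecureTotalDominating E S
  secure = dominating b∈S a∈S (flip ab) , exchange
    where
    exchange : ∀ x → x ∉ S → ∃ λ v → v ∈ S × E x v ≡ true × TotalDominating E (swap S v x)
    exchange x x∉ with all x
    ... | inj₁ refl                = contradiction a∈S x∉
    ... | inj₂ (inj₁ refl)         = contradiction b∈S x∉
    ... | inj₂ (inj₂ (inj₁ refl))  = a , a∈S , flip au , swapped bu
    ... | inj₂ (inj₂ (inj₂ refl))  = a , a∈S , flip aw , swapped bw

  -- The neighbours y, u and w of x are distinct: y is adjacent to both u and w, and these differ.
  3≤degree : ∀ {x y} → E y u ≡ true → E y w ≡ true → E x y ≡ true → E x u ≡ true → E x w ≡ true → 3 ≤ degree E x
  3≤degree {x} {y} yu yw xy xu xw = begin
    3                                                  ≡⟨ cong₂ _+_ (cong₂ _+_ (∑-δ y 1) (∑-δ u 1)) (∑-δ w 1) ⟨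
    ∑ (δ y 1) + ∑ (δ u 1) + ∑ (δ w 1)                  ≡⟨ cong (_+ ∑ (δ w 1)) (∑-distrib-+ (δ y 1) (δ u 1)) ⟨
    ∑ (λ z → δ y 1 z + δ u 1 z) + ∑ (δ w 1)            ≤⟨ ∑-superadditive (λ z → δ y 1 z + δ u 1 z) (δ w 1) (bit ∘ E x) pointwise ⟩
    ∑ (bit ∘ E x)                                      ≡⟨ ∣tabulate∣ (E x) ⟨
    degree E x                                         ∎
    where
    open ≤-Reasoning
    pointwise : ∀ z → δ y 1 z + δ u 1 z + δ w 1 z ≤ bit (E x z)
    pointwise z with z ≟ y | z ≟ u | z ≟ w
    ... | yes refl | yes z≡u  | _        = contradiction z≡u (adjacent⇒≢ yu)
    ... | yes refl | no _     | yes z≡w  = contradiction z≡w (adjacent⇒≢ yw)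
    ... | yes refl | no _     | no _     rewrite xy = ≤-refl
    ... | no _     | yes refl | yes u≡w  = contradiction u≡w u≢w
    ... | no _     | yes refl | no _     rewrite xu = ≤-refl
    ... | no _     | no _     | yes refl rewrite xw = ≤-refl
    ... | no _     | no _     | no _     = z≤n

  goal : Goal E
  goal = S , secure , ∣S∣≤ , λ x x∈ eq → <-irrefl refl (subst (3 ≤_) eq (3≤ x x∈))
    where
    ∣S∣≤ : ∣ S ∣ ≤ (2 * n) / 3
    -- Here 2n ≥ 8 ≥ 6, and 6 / 3 = 2.
    ∣S∣≤ = ≤-trans ∣S∣≤2 (/-monoˡ-≤ 3 (≤-trans (m≤m+n 6 2) (*-monoʳ-≤ 2 4≤n)))
    3≤ : ∀ x → x ∈ S → 3 ≤ degree E x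
    3≤ x x∈ with S∈ x∈
    ... | inj₁ refl = 3≤degree bu bw ab au aw
    ... | inj₂ refl = 3≤degree au aw (flip ab) bu bw

module _ {n : ℕ} {E : Adj n} {rank : Fin n → ℕ} (rank-injective : ∀ {x y} → rank x ≡ rank y → x ≡ y)
  (symmetric : ∀ u v → E u v ≡ E v u) (loopless : ∀ u → E u u ≡ false) (4≤n : 4 ≤ n) where

  private
    flip : ∀ {x y} → E x y ≡ true → E y x ≡ true
    flip {x} {y} e = trans (symmetric y x) e

    _⊕_ : ∀ {i j k l} (s : Triangulated E rank i j) (t : Triangulated E rank k l) → 2 ≤ sides E rank s + sides E rank t
    s ⊕ t = +-mono-≤ (1≤sides s) (1≤sides t)

  -- One or two sides leave at most three vertices, contrary to 4 ≤ n. Three sides give a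
  -- quadrilateral, cut by one of its two diagonals; all other shapes have at least four sides.
  few-sides⇒goal : ∀ {i j} (t : Triangulated E rank i j) →
    (∀ x → x ∈ˡ i ∷ j ∷ inner t) → sides E rank t < 4 → Goal E
  few-sides⇒goal (side _ _ _) cover _ = contradiction (≤-trans 4≤n (length-cover cover)) λ { (s≤s (s≤s ())) }
  few-sides⇒goal (triangle _ _ _ _ (side _ _ _) (side _ _ _)) cover _ =
    contradiction (≤-trans 4≤n (length-cover cover)) λ { (s≤s (s≤s (s≤s ()))) }
  -- The triangles ikj and klj share kj, so k and j are the centres; in the mirror case below these
  -- are i and k.
  few-sides⇒goal {i} {j} (triangle k i<k k<j ij (side _ _ ik) (triangle l k<l l<j kj (side _ _ kl) (side _ _ lj))) cover _ =
    Diamond.goal symmetric loopless 4≤n kj (flip ik) (flip ij) kl (flip lj)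
      (λ { refl → <-asym i<k k<l }) λ x → case cover x of λ
        { (here x≡i) → inj₂ (inj₂ (inj₁ x≡i)) ; (there (here x≡j)) → inj₂ (inj₁ x≡j)
        ; (there (there (here x≡k))) → inj₁ x≡k ; (there (there (there (here x≡l)))) → inj₂ (inj₂ (inj₂ x≡l)) }
  few-sides⇒goal {i} {j} (triangle k i<k k<j ij (triangle l i<l l<k ik (side _ _ il) (side _ _ lk)) (side _ _ kj)) cover _ =
    Diamond.goal symmetric loopless 4≤n ik ij kj il (flip lk)
      (λ { refl → <-asym k<j l<k }) λ x → case cover x of λ
        { (here x≡i) → inj₁ x≡i ; (there (here x≡j)) → inj₂ (inj₂ (inj₁ x≡j))
        ; (there (there (here x≡k))) → inj₂ (inj₁ x≡k) ; (there (there (there (here x≡l)))) → inj₂ (inj₂ (inj₂ x≡l)) }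
  few-sides⇒goal (triangle _ _ _ _ (side _ _ _) (triangle _ _ _ _ (side _ _ _) (triangle _ _ _ _ s t))) _ <4 =
    contradiction <4 (≤⇒≯ (+-monoʳ-≤ 2 (s ⊕ t)))
  few-sides⇒goal (triangle _ _ _ _ r@(side _ _ _) (triangle _ _ _ _ (triangle _ _ _ _ s t) u)) _ <4 =
    contradiction <4 (≤⇒≯ (s≤s (+-mono-≤ (s ⊕ t) (1≤sides u))))
  few-sides⇒goal (triangle _ _ _ _ (triangle _ _ _ _ r (triangle _ _ _ _ s t)) u@(side _ _ _)) _ <4 =
    contradiction <4 (≤⇒≯ (+-mono-≤ (+-mono-≤ (1≤sides r) (s ⊕ t)) (1≤sides u)))
  few-sides⇒goal (triangle _ _ _ _ (triangle _ _ _ _ (triangle _ _ _ _ s t) r@(side _ _ _)) u@(side _ _ _)) _ <4 =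
    contradiction <4 (≤⇒≯ (+-mono-≤ (+-mono-≤ (s ⊕ t) (1≤sides r)) (1≤sides u)))
  few-sides⇒goal (triangle _ _ _ _ (triangle _ _ _ _ r s) (triangle _ _ _ _ t u)) _ <4 =
    contradiction <4 (≤⇒≯ (+-mono-≤ (r ⊕ s) (t ⊕ u)))

  triangulated⇒goal : ∀ {i j} → Triangulated E rank i j →
    (∀ x → rank i ≤ rank x) → (∀ x → rank x ≤ rank j) → Goal E
  triangulated⇒goal t first last with 4 ≤? sides E rank t
  ... | no 4≰  = few-sides⇒goal t (covering rank-injective first last t) (≰⇒> 4≰)
  ... | yes 4≤ =
    let p , p∈ , ≤p , ps = realise rank-injective symmetric loopless t
        complete = All.lookup profiles-complete p∈ (subst (_≤ size p) (m≤n⇒m⊓n≡m 4≤) ≤p)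
        r , c = All.lookupAny ps complete
    in realised⇒goal rank-injective first last c r

two-elements : ∀ {n} → 2 ≤ n → ∃₂ λ (a b : Fin n) → a ≢ b
two-elements (s≤s (s≤s _)) = zero , suc zero , λ ()

theorem3p3 : (n : ℕ) (E : Adj n) → IsSimple E → MaximalOuterplanar E → 4 ≤ n →
    ∃ λ (S : Subset n) → SecureTotalDominating E S × ∣ S ∣ ≤ (2 * n) / 3 ×
    (∀ (v : Fin n) → v ∈ S → degree E v ≢ 2)
theorem3p3 n E (symmetric , loopless) ((pos , injective , noncrossing) , maximal) 4≤n =
  let _ , _ , a≢b = two-elements (≤-trans (s≤s (s≤s z≤n)) 4≤n)
      i , j , i<j , ij , first , last = outerEdge a≢b
  in triangulated⇒goal rank-injective symmetric loopless 4≤n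
       (triangulate (rank j) (m≤m+n (rank j) (rank i)) i<j ij) first last
  where open Maximal symmetric pos injective noncrossing maximal
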